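{- Suppose $d\ge 1$ and $n\ge 4$ are integers. Then $C_n$ is $2,d$-perfect if and only if either (1) $n\le 2d+1$, or (2) $n\ge 2d+2$ and $(d+1)\mid n$.
   Context: $C_n$ is the cycle graph on $n$ vertices. All graphs are simple and undirected with nonempty vertex set. A shortest path in a graph $G$ is a path between some vertices $u,v$ whose length (number of edges) equals the graph distance between $u$ and $v$. A set $S\subseteq V(G)$ is $k,d$-independent in $G$ if every shortest path in $G$ of length at most $d$ contains fewer than $k$ vertices of $S$. The $k,d$-chromatic number $\chi^k_d(G)$ is the least positive integer $c$ such that some coloring $V(G)\to\{1,\dots,c\}$ has all color classes $k,d$-independent. A set $S\subseteq V(G)$ is a $k,d$-clique in $G$ if every $k$-element subset of $S$ is contained in some shortest path of $G$ of length at most $d$; $\omega^k_d(G)$ is the supremum of the sizes of $k,d$-cliques in $G$. For $2\le k\le d+1$, $G$ is $k,d$-perfect if $\chi^k_d(H)=\left\lceil\frac{\omega^k_d(H)}{k-1}\right\rceil$ for every induced subgraph $H$ of $G$ (shortest paths being computed in $H$). Here $k=2$. -}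

module Defs where

open import Data.Bool.Base using (Bool; T)
open import Data.Fin.Base using (Fin; toℕ; fromℕ<)
open import Data.List.Base using (List; []; _∷_; length)
open import Data.List.Relation.Binary.Subset.Propositional using (_⊆_)
open import Data.List.Relation.Unary.All using (All)
open import Data.List.Relation.Unary.Unique.Propositional using (Unique)
open import Data.Nat.Base
open import Data.Nat.DivMod using (_/_)
open import Data.Nat.Properties using (1+n≢n; ≤-trans)
open import Data.Product.Base using (Σ-syntax; ∃; ∃₂; _×_; proj₁)
open import Function.Base using (_∘_; _on_)
open import Level using (0ℓ)
open import Relation.Binary.Construct.Closure.ReflexiveTransitive using (Star; ε; _◅_)
open import Relation.Binary.Construct.Closure.Symmetric using (SymClosure; fwd; bwd; symmetric)
open import Relation.Binary.Core using (Rel)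
open import Relation.Binary.Definitions using (Symmetric)
open import Relation.Binary.PropositionalEquality.Core using (_≡_; sym; trans; cong)
open import Relation.Nullary.Negation.Core using (¬_)
open import Relation.Unary using (Pred)

------------------------------------------------------------------------
-- Extrema of sets of natural numbers, and ceiling division

IsLeast : Pred ℕ 0ℓ → Pred ℕ 0ℓ
IsLeast P m = P m × (∀ j → P j → m ≤ j)

IsUpperBound : Pred ℕ 0ℓ → Pred ℕ 0ℓ
IsUpperBound P m = ∀ j → P j → j ≤ m

IsSupremum : Pred ℕ 0ℓ → Pred ℕ 0ℓ
IsSupremum P = IsLeast (IsUpperBound P)

⌈_/_⌉ : ℕ → (m : ℕ) .{{_ : NonZero m}} → ℕ
⌈ a / m ⌉ = (a + pred m) / m

------------------------------------------------------------------------
-- Graphs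

record Graph : Set₁ where
  infix 4 _~_
  field
    V        : Set
    _~_      : Rel V 0ℓ
    ~-sym    : Symmetric _~_
    ~-irrefl : ∀ v → ¬ (v ~ v)
    nonempty : V

-- Subsets are Boolean-valued so that a vertex of the induced subgraph is
-- determined by its underlying vertex of G (T b has at most one proof).
induced : (G : Graph) (U : Graph.V G → Bool) → ∃ (T ∘ U) → Graph
induced G U u = record
  { V        = ∃ (T ∘ U)
  ; _~_      = _~_ on proj₁
  ; ~-sym    = ~-sym
  ; ~-irrefl = ~-irrefl ∘ proj₁
  ; nonempty = u
  }
  where open Graph G

module _ (G : Graph) where
  open Graph G

  Walk : Rel V 0ℓ
  Walk = Star _~_

  walkLength : ∀ {u v} → Walk u v → ℕ
  walkLength ε       = 0
  walkLength (_ ◅ p) = suc (walkLength p)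

  vertices : ∀ {u v} → Walk u v → List V
  vertices {u} ε       = u ∷ []
  vertices {u} (_ ◅ p) = u ∷ vertices p

  IsPath : ∀ {u v} → Walk u v → Set
  IsPath p = Unique (vertices p)

  IsDistance : V → V → ℕ → Set
  IsDistance u v = IsLeast λ ℓ → Σ[ p ∈ Walk u v ] IsPath p × walkLength p ≡ ℓ

  IsShortestPath : ∀ {u v} → Walk u v → Set
  IsShortestPath {u} {v} p = IsPath p × IsDistance u v (walkLength p)

  -- Below, finite sets of vertices are represented by repetition-free lists.

  Independent : (k d : ℕ) → Pred V 0ℓ → Set
  Independent k d S =
    ∀ {u v} (p : Walk u v) → IsShortestPath p → walkLength p ≤ d →
    ∀ (xs : List V) → Unique xs → All S xs → xs ⊆ vertices p → length xs < k

  Colorable : (k d c : ℕ) → Set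
  Colorable k d c =
    Σ[ f ∈ (V → Fin c) ] (∀ i → Independent k d (λ v → f v ≡ i))

  IsChromaticNumber : (k d : ℕ) → ℕ → Set
  IsChromaticNumber k d = IsLeast λ c → 0 < c × Colorable k d c

  Clique : (k d : ℕ) → List V → Set
  Clique k d S =
    ∀ (xs : List V) → Unique xs → length xs ≡ k → xs ⊆ S →
    ∃₂ λ u v → Σ[ p ∈ Walk u v ]
      IsShortestPath p × walkLength p ≤ d × xs ⊆ vertices p

  IsCliqueNumber : (k d : ℕ) → ℕ → Set
  IsCliqueNumber k d =
    IsSupremum λ s → Σ[ S ∈ List V ] Unique S × Clique k d S × length S ≡ s

pred-nonZero : ∀ k .{{_ : NonTrivial k}} → NonZero (pred k)
pred-nonZero (2+ _) = _

-- χ and ω are given relationally, so the equation also asserts that both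
-- exist as natural numbers.  The notion is meant for 2 ≤ k ≤ d + 1; the
-- lower bound is the instance argument.
Perfect : (k d : ℕ) .{{_ : NonTrivial k}} → Graph → Set
Perfect k d G =
  ∀ (U : Graph.V G → Bool) (u : ∃ (T ∘ U)) → let H = induced G U u in
  ∃₂ λ χ ω → IsChromaticNumber H k d χ × IsCliqueNumber H k d ω ×
             χ ≡ ⌈ ω / pred k ⌉ {{pred-nonZero k}}

------------------------------------------------------------------------
-- Cycle graphs

data Next {n : ℕ} (i j : Fin n) : Set where
  step : suc (toℕ i) ≡ toℕ j → Next i j
  wrap : suc (toℕ i) ≡ n → toℕ j ≡ 0 → Next i j

Next-irrefl : ∀ {n} → 3 ≤ n → (i : Fin n) → ¬ Next i i
Next-irrefl _             i (step e)   = 1+n≢n e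
Next-irrefl (s≤s (s≤s _)) i (wrap e z) with () ← trans (sym (cong suc z)) e

Cycle : (n : ℕ) → 3 ≤ n → Graph
Cycle n 3≤n = record
  { V        = Fin n
  ; _~_      = SymClosure Next
  ; ~-sym    = symmetric Next
  ; ~-irrefl = λ { v (fwd r) → Next-irrefl 3≤n v r
                 ; v (bwd r) → Next-irrefl 3≤n v r }
  ; nonempty = fromℕ< (≤-trans (s≤s z≤n) 3≤n)
  }

{-# OPTIONS --safe #-}
-- For k = 2, χ and ω of H are the chromatic and clique numbers of the graph
-- that joins vertices at distance at most d in H.  Put D = d + 1.
--
-- If H omits a vertex of the cycle, let r x be the number of consecutive
-- vertices of H just before x; if H is the whole cycle and D divides n, let
-- r x = x.  In both cases r increases by one modulo D along the cycle, so
-- r modulo D is a proper colouring, and walking back from a vertex of the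
-- largest colour to colour 0 gives a clique of matching size.  If n ≤ 2d + 1,
-- the whole cycle is itself a clique.
--
-- Conversely, let n ≥ 2D.  A clique has at most D elements: the vertices at
-- displacements i and i - D from a fixed member are D > d apart, so at most
-- one of them belongs to the clique.  A colouring with D colours has period D
-- by the pigeonhole principle, so the vertices 0 and n mod D share a colour,
-- which forces n mod D = 0.

module Submission where

open import Data.Bool.Base using (Bool; true; false; T; if_then_else_)
open import Data.Bool.Properties using (T?; T-irrelevant)
open import Data.Fin.Base as Fin using (Fin; toℕ; fromℕ<)
open import Data.Fin.Properties as Fin using (toℕ<n; toℕ-injective; toℕ-fromℕ<; fromℕ<-injective)
open import Data.List.Base using (List; []; _∷_; length; lookup; map; allFin; concatMap)
open import Data.List.Extrema.Nat using (argmax; f[xs]≤f[argmax])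
open import Data.List.Membership.Propositional using (_∈_; find; lose)
open import Data.List.Membership.Propositional.Properties using (∈-allFin; ∈-concatMap⁺; ∈-lookup)
open import Data.List.Properties using (length-map; length-tabulate)
open import Data.List.Relation.Unary.All as All using (All; []; _∷_)
open import Data.List.Relation.Unary.AllPairs using (AllPairs; []; _∷_)
open import Data.List.Relation.Unary.Any as Any using (here; there)
open import Data.List.Relation.Unary.Unique.Propositional using (Unique)
open import Data.List.Relation.Unary.Unique.Propositional.Properties as Unique using (allFin⁺)
open import Data.Nat.Base
open import Data.Nat.Divisibility using (_∣_; n∣m⇒m%n≡0; m%n≡0⇒n∣m; divides)
open import Data.Nat.DivMod
open import Data.Nat.Properties
open import Data.Product.Base using (Σ-syntax; ∃; ∃₂; _×_; _,_; proj₁)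
open import Data.Sum.Base using (_⊎_; inj₁; inj₂; [_,_])
open import Function.Base using (_∘_; id)
open import Function.Bundles using (_⇔_; mk⇔)
open import Level using (0ℓ)
open import Relation.Binary.Construct.Closure.ReflexiveTransitive using (ε; _◅_; _◅◅_)
open import Relation.Binary.Construct.Closure.Symmetric using (fwd; bwd)
open import Relation.Binary.Core using (Rel)
open import Relation.Binary.Definitions using (Decidable; DecidableEquality)
open import Relation.Binary.PropositionalEquality hiding ([_])
open import Relation.Nullary.Decidable using (Dec; yes; no; map′; _×-dec_; _⊎-dec_; ¬?; decidable-stable)
open import Relation.Nullary.Negation using (¬_; contradiction)
open import Relation.Unary as Unary using (Pred)
open import Defs

-- Least witnesses and the pigeonhole bound.

least : ∀ {P : Pred ℕ 0ℓ} → Unary.Decidable P → ∀ m → P m → ∃ (IsLeast P)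
least P? m pm with P? 0
... | yes p0 = 0 , p0 , λ _ _ → z≤n
least P? zero pm | no ¬p0 = contradiction pm ¬p0
least {P} P? (suc m) pm | no ¬p0 with least {P ∘ suc} (P? ∘ suc) m pm
... | k , pk , k≤ = suc k , pk , minimal
  where
  minimal : ∀ j → P j → suc k ≤ j
  minimal zero    pj = contradiction pj ¬p0
  minimal (suc j) pj = s≤s (k≤ j pj)

unique-lookup : ∀ {A : Set} {xs : List A} → Unique xs → ∀ {i j} → i Fin.< j →
                lookup xs i ≢ lookup xs j
unique-lookup (x≢ ∷ _)   {Fin.zero}  {Fin.suc j} _         e = All.lookup x≢ (∈-lookup j) e
unique-lookup (_ ∷ uniq) {Fin.suc i} {Fin.suc j} (s≤s i<j) e = unique-lookup uniq i<j e

-- Pigeonhole on list positions. The map takes a membership proof because `key` in `clique-length≤`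
-- is defined only on members of the clique.
length≤ : ∀ {A : Set} {c} {xs : List A} → Unique xs →
          (f : ∀ {y} → y ∈ xs → Fin c) →
          (∀ {y z} (p : y ∈ xs) (q : z ∈ xs) → f p ≡ f q → y ≡ z) → length xs ≤ c
length≤ {c = c} {xs} uniq f inj = ≮⇒≥ λ c<len →
  let i , j , i<j , e = Fin.pigeonhole c<len (λ i → f (∈-lookup {xs = xs} i))
  in unique-lookup uniq i<j (inj (∈-lookup i) (∈-lookup j) e)

-- Walks of bounded length.

-- Arbitrary walks are allowed, so that concatenation and reversal need no check for repeated
-- vertices; `shortestPath` restores a path.
Near : (G : Graph) → ℕ → Rel (Graph.V G) 0ℓ
Near G d u v = Σ[ p ∈ Walk G u v ] walkLength G p ≤ d

Chromatic≡Clique : Graph → ℕ → Set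
Chromatic≡Clique G d = ∃₂ λ χ ω → IsChromaticNumber G 2 d χ × IsCliqueNumber G 2 d ω × χ ≡ ⌈ ω / 1 ⌉

module _ {G : Graph} where
  open Graph G

  near-refl : ∀ {d u} → Near G d u u
  near-refl = ε , z≤n

  near-step : ∀ {d u v w} → u ~ v → Near G d v w → Near G (suc d) u w
  near-step e (p , p≤) = e ◅ p , s≤s p≤

  near-mono : ∀ {c d u v} → c ≤ d → Near G c u v → Near G d u v
  near-mono c≤d (p , p≤) = p , ≤-trans p≤ c≤d

  length-◅◅ : ∀ {u v w} (p : Walk G u v) (q : Walk G v w) →
              walkLength G (p ◅◅ q) ≡ walkLength G p + walkLength G q
  length-◅◅ ε       q = refl
  length-◅◅ (_ ◅ p) q = cong suc (length-◅◅ p q)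

  reverse : ∀ {u v} (p : Walk G u v) → Near G (walkLength G p) v u
  reverse ε       = near-refl
  reverse (e ◅ p) with q , q≤ ← reverse p = q ◅◅ (~-sym e ◅ ε) , (begin
    walkLength G (q ◅◅ (~-sym e ◅ ε)) ≡⟨ length-◅◅ q _ ⟩
    walkLength G q + 1                ≡⟨ +-comm _ 1 ⟩
    suc (walkLength G q)              ≤⟨ s≤s q≤ ⟩
    suc (walkLength G p)              ∎)
    where open ≤-Reasoning

  near-sym : ∀ {d u v} → Near G d u v → Near G d v u
  near-sym (p , p≤) = near-mono p≤ (reverse p)

  start∈ : ∀ {u v} (p : Walk G u v) → u ∈ vertices G p
  start∈ ε       = here refl
  start∈ (_ ◅ _) = here refl

  end∈ : ∀ {u v} (p : Walk G u v) → v ∈ vertices G p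
  end∈ ε       = here refl
  end∈ (_ ◅ p) = there (end∈ p)

  near-prefix : ∀ {u v w} (p : Walk G u v) → w ∈ vertices G p → Near G (walkLength G p) u w
  near-prefix ε       (here refl) = near-refl
  near-prefix (_ ◅ _) (here refl) = near-refl
  near-prefix (e ◅ p) (there w∈)  = near-step e (near-prefix p w∈)

  near-suffix : ∀ {u v w} (p : Walk G u v) → w ∈ vertices G p → Near G (walkLength G p) w v
  near-suffix ε       (here refl) = near-refl
  near-suffix (e ◅ p) (here refl) = e ◅ p , ≤-refl
  near-suffix (_ ◅ p) (there w∈)  = near-mono (n≤1+n _) (near-suffix p w∈)

  near-vertices : ∀ {u v x y} (p : Walk G u v) → x ∈ vertices G p → y ∈ vertices G p →
                  Near G (walkLength G p) x y
  near-vertices p@ε       (here refl) y∈          = near-prefix p y∈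
  near-vertices p@(_ ◅ _) (here refl) y∈          = near-prefix p y∈
  near-vertices p@(_ ◅ _) x∈@(there _) (here refl) = near-sym (near-prefix p x∈)
  near-vertices (_ ◅ p)   (there x∈)  (there y∈)  = near-mono (n≤1+n _) (near-vertices p x∈ y∈)

  -- If the start recurred, the suffix from the recurrence would be a shorter walk between the same
  -- ends. Tails of minimal walks are again minimal, which gives the induction.
  minimal⇒path : ∀ {u v} (p : Walk G u v) → (∀ q → walkLength G p ≤ walkLength G {u} {v} q) → IsPath G p
  minimal⇒path ε       _   = [] ∷ []
  minimal⇒path {u} (e ◅ p) min = All.tabulate new ∷ minimal⇒path p (λ q → s≤s⁻¹ (min (e ◅ q)))
    where
    new : ∀ {w} → w ∈ vertices G p → u ≢ w
    new w∈ refl with q , q≤ ← near-suffix p w∈ = 1+n≰n (≤-trans (min q) q≤)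

-- Independence and cliques as distance conditions.

record Finite (G : Graph) : Set where
  open Graph G
  infix 4 _≟ᵛ_ _~?_
  field
    _≟ᵛ_     : DecidableEquality V
    _~?_     : Decidable _~_
    elements : List V
    complete : ∀ v → v ∈ elements

module _ {G : Graph} (finite : Finite G) where
  open Graph G
  open Finite finite

  walk? : ∀ ℓ u v → Dec (Σ[ p ∈ Walk G u v ] walkLength G p ≡ ℓ)
  walk? zero u v = map′ (λ { refl → ε , refl }) (λ { (ε , _) → refl }) (u ≟ᵛ v)
  walk? (suc ℓ) u v = map′ to from (Any.any? (λ w → (u ~? w) ×-dec walk? ℓ w v) elements)
    where
    to : Any.Any _ elements → Σ[ p ∈ Walk G u v ] walkLength G p ≡ suc ℓ
    to any with _ , _ , e , p , refl ← find any = e ◅ p , refl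
    from : Σ[ p ∈ Walk G u v ] walkLength G p ≡ suc ℓ → Any.Any _ elements
    from (_◅_ {j = w} e p , eq) = lose (complete w) (e , p , suc-injective eq)

  -- Walks of a given length can be searched for, so a least length can be found; by minimality a
  -- walk of that length repeats no vertex and realises the distance.
  shortestPath : ∀ {d u v} → Near G d u v →
                 Σ[ p ∈ Walk G u v ] IsShortestPath G p × walkLength G p ≤ d
  shortestPath {u = u} {v} (q , q≤d) with least (λ ℓ → walk? ℓ u v) _ (q , refl)
  ... | _ , (p , refl) , min = p , (isPath , (p , isPath , refl) , λ { _ (r , _ , refl) → min _ (r , refl) })
                                 , ≤-trans (min _ (q , refl)) q≤d
    where isPath = minimal⇒path p (λ r → min _ (r , refl))

  -- Two distinct members at distance at most `d` would both lie on a shortest path joining them,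
  -- which may contain fewer than two members.
  independent⇒near-≡ : ∀ {d S x y} → Independent G 2 d S → S x → S y → Near G d x y → x ≡ y
  independent⇒near-≡ {x = x} {y} ind sx sy near = decidable-stable (x ≟ᵛ y) λ x≢y →
    let p , shortest , p≤d = shortestPath near
    in 1+n≰n (ind p shortest p≤d (x ∷ y ∷ []) ((x≢y ∷ []) ∷ [] ∷ []) (sx ∷ sy ∷ [])
                λ { (here refl) → start∈ p ; (there (here refl)) → end∈ p })

  near-≡⇒independent : ∀ {d} {S : Pred V 0ℓ} → (∀ {x y} → S x → S y → Near G d x y → x ≡ y) →
                      Independent G 2 d S
  near-≡⇒independent h p _ p≤d []       _ _ _ = z<s
  near-≡⇒independent h p _ p≤d (_ ∷ []) _ _ _ = s<s z<s
  near-≡⇒independent h p _ p≤d (x ∷ y ∷ _) ((x≢y ∷ _) ∷ _) (sx ∷ sy ∷ _) ⊆p =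
    contradiction (h sx sy (near-mono p≤d (near-vertices p (⊆p (here refl)) (⊆p (there (here refl)))))) x≢y

  clique⇒near : ∀ {d S x y} → Clique G 2 d S → x ∈ S → y ∈ S → Near G d x y
  clique⇒near {x = x} {y} clique x∈ y∈ with x ≟ᵛ y
  ... | yes refl = near-refl
  ... | no  x≢y
    with _ , _ , p , _ , p≤d , ⊆p ← clique (x ∷ y ∷ []) ((x≢y ∷ []) ∷ [] ∷ []) refl
           (λ { (here refl) → x∈ ; (there (here refl)) → y∈ })
    = near-mono p≤d (near-vertices p (⊆p (here refl)) (⊆p (there (here refl))))

  near⇒clique : ∀ {d S} → (∀ {x y} → x ∈ S → y ∈ S → Near G d x y) → Clique G 2 d S
  near⇒clique near (x ∷ y ∷ []) _ refl ⊆S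
    with p , shortest , p≤d ← shortestPath (near (⊆S (here refl)) (⊆S (there (here refl))))
    = _ , _ , p , shortest , p≤d , λ { (here refl) → start∈ p ; (there (here refl)) → end∈ p }

  allPairs⇒clique : ∀ {d S} → AllPairs (Near G d) S → Clique G 2 d S
  allPairs⇒clique pairs = near⇒clique (near pairs)
    where
    near : ∀ {d S x y} → AllPairs (Near G d) S → x ∈ S → y ∈ S → Near G d x y
    near (_ ∷ _)     (here refl) (here refl) = near-refl
    near (from ∷ _)  (here refl) (there y∈)  = All.lookup from y∈
    near (from ∷ _)  (there x∈)  (here refl) = near-sym (All.lookup from x∈)
    near (_ ∷ pairs) (there x∈)  (there y∈)  = near pairs x∈ y∈

  -- A proper colouring is injective on every clique. Any colouring, restricted to `S`, thus uses at
  -- least `c` colours, and `f` bounds every clique by `c`.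
  χ≡ω : ∀ {d c} (f : V → Fin c) → (∀ {x y} → f x ≡ f y → Near G d x y → x ≡ y) →
        ∀ S → Unique S → Clique G 2 d S → length S ≡ c →
        Chromatic≡Clique G d
  χ≡ω {d} {c} f proper S uniq clique len =
    c , c
    , ((≤-trans (s≤s z≤n) (toℕ<n (f nonempty)) , f , λ i → near-≡⇒independent λ { refl fy≡ → proper (sym fy≡) })
      , λ { j (_ , g , ind) → subst (_≤ j) len
          (bound uniq clique g λ gx≡gy → independent⇒near-≡ (ind _) gx≡gy refl) })
    , ((λ { _ (S′ , uniq′ , clique′ , refl) → bound uniq′ clique′ f proper })
      , λ j upper → upper c (S , uniq , clique , len))
    -- With `k` = 2 the ceiling unfolds to `(c + 0) / 1`.
    , sym (trans (n/1≡n (c + 0)) (+-identityʳ c))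
    where
    bound : ∀ {S b} → Unique S → Clique G 2 d S → (g : V → Fin b) →
            (∀ {x y} → g x ≡ g y → Near G d x y → x ≡ y) → length S ≤ b
    bound uniq clique g proper =
      length≤ uniq (λ {y} _ → g y) λ x∈ y∈ e → proper e (clique⇒near clique x∈ y∈)

-- Congruences of natural numbers.

-- A record rather than the bare equation, so that x, y and m can be inferred.
infix 4 _≈_[mod_]
record _≈_[mod_] (x y m : ℕ) .{{_ : NonZero m}} : Set where
  constructor mod-eq
  field
    %-≡ : x % m ≡ y % m

open _≈_[mod_]

module _ {m : ℕ} .{{_ : NonZero m}} where

  ≈-reflexive : ∀ {x y} → x ≡ y → x ≈ y [mod m ]
  ≈-reflexive refl = mod-eq refl

  ≈-sym : ∀ {x y} → x ≈ y [mod m ] → y ≈ x [mod m ]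
  ≈-sym (mod-eq e) = mod-eq (sym e)

  ≈-trans : ∀ {x y z} → x ≈ y [mod m ] → y ≈ z [mod m ] → x ≈ z [mod m ]
  ≈-trans (mod-eq e) (mod-eq f) = mod-eq (trans e f)

  ≈-+ʳ : ∀ {x y} k → x ≈ y [mod m ] → x + k ≈ y + k [mod m ]
  ≈-+ʳ {x} {y} k (mod-eq e) = mod-eq (begin
    (x + k) % m         ≡⟨ %-distribˡ-+ x k m ⟩
    (x % m + k % m) % m ≡⟨ cong (λ z → (z + k % m) % m) e ⟩
    (y % m + k % m) % m ≡⟨ %-distribˡ-+ y k m ⟨
    (y + k) % m         ∎)
    where open ≡-Reasoning

  ≈-+ˡ : ∀ {x y} k → x ≈ y [mod m ] → k + x ≈ k + y [mod m ]
  ≈-+ˡ {x} {y} k e = subst₂ (λ a b → a ≈ b [mod m ]) (+-comm x k) (+-comm y k) (≈-+ʳ k e)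

  -- Adding (m - 1) k to both sides turns the summand k into a multiple of m.
  ≈-cancelʳ : ∀ {x y} k → x + k ≈ y + k [mod m ] → x ≈ y [mod m ]
  ≈-cancelʳ {x} {y} k e = ≈-trans (≈-sym (absorb x)) (≈-trans (≈-+ʳ (k * pred m) e) (absorb y))
    where
    open ≡-Reasoning
    absorb : ∀ z → z + k + k * pred m ≈ z [mod m ]
    absorb z = mod-eq (begin
      (z + k + k * pred m) % m   ≡⟨ cong (_% m) (+-assoc z k _) ⟩
      (z + (k + k * pred m)) % m ≡⟨ cong (λ l → (z + l) % m) (*-suc k (pred m)) ⟨
      (z + k * suc (pred m)) % m ≡⟨ cong (λ l → (z + k * l) % m) (suc-pred m) ⟩
      (z + k * m) % m            ≡⟨ [m+kn]%n≡m%n z k m ⟩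
      z % m                      ∎)

  ≈-cancelˡ : ∀ {x y} k → k + x ≈ k + y [mod m ] → x ≈ y [mod m ]
  ≈-cancelˡ {x} {y} k e = ≈-cancelʳ k (subst₂ (λ a b → a ≈ b [mod m ]) (+-comm k x) (+-comm k y) e)

  m≈0 : m ≈ 0 [mod m ]
  m≈0 = mod-eq ([m+n]%n≡m%n 0 m)

  ≈-small : ∀ {x y} → x < m → y < m → x ≈ y [mod m ] → x ≡ y
  ≈-small x<m y<m (mod-eq e) = trans (sym (m<n⇒m%n≡m x<m)) (trans e (m<n⇒m%n≡m y<m))

  ≈-gap : ∀ x {k} → k < m → x ≈ x + k [mod m ] → k ≡ 0
  ≈-gap x {k} k<m e = sym (≈-small (≤-<-trans z≤n k<m) k<m
    (≈-cancelˡ x (≈-trans (≈-reflexive (+-identityʳ x)) e)))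

  -- The bounds exclude every quotient but 1. The offsets of `near-shift` satisfy them with `m` =
  -- `D`, where the value `D` stands for displacement zero.
  ≈0⇒≡m : ∀ {k} → 0 < k → k < m + m → k ≈ 0 [mod m ] → k ≡ m
  ≈0⇒≡m {k} 0<k k<2m (mod-eq e) with m%n≡0⇒n∣m k m (trans e (m*n%n≡0 0 m))
  ... | divides 0 refl = contradiction 0<k λ ()
  ... | divides 1 eq = trans eq (+-identityʳ m)
  ... | divides (2+ q) eq = contradiction k<2m (≤⇒≯ (begin
    m + m           ≤⟨ m≤m+n (m + m) (q * m) ⟩
    m + m + q * m   ≡⟨ +-assoc m m _ ⟩
    m + (m + q * m) ≡⟨ eq ⟨
    k               ∎))
    where open ≤-Reasoning

  suc-% : ∀ x → suc x % m ≡ suc (x % m) ⊎ (suc (x % m) ≡ m × suc x % m ≡ 0)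
  suc-% x with m≤n⇒m<n∨m≡n (m%n<n x m) | %-≡ (≈-+ˡ 1 (mod-eq (sym (m%n%n≡m%n x m))))
  ... | inj₁ lt | wrapped = inj₁ (trans wrapped (m<n⇒m%n≡m lt))
  ... | inj₂ eq | wrapped = inj₂ (eq , trans wrapped (trans (cong (_% m) eq) (n%n≡0 m)))

-- Residues as vertices of the cycle.

module _ {n : ℕ} .{{_ : NonZero n}} where

  toℕ-mod : ∀ t → toℕ (t mod n) ≡ t % n
  toℕ-mod t = toℕ-fromℕ< (m%n<n t n)

  mod-cong : ∀ {s t} → s ≈ t [mod n ] → s mod n ≡ t mod n
  mod-cong {s} {t} e = toℕ-injective (trans (toℕ-mod s) (trans (%-≡ e) (sym (toℕ-mod t))))

  toℕ-mod-id : ∀ i → toℕ i mod n ≡ i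
  toℕ-mod-id i = toℕ-injective (trans (toℕ-mod (toℕ i)) (m<n⇒m%n≡m (toℕ<n i)))

  n+toℕ-mod-id : ∀ i → (n + toℕ i) mod n ≡ i
  n+toℕ-mod-id i = trans (mod-cong (≈-+ʳ (toℕ i) m≈0)) (toℕ-mod-id i)

  next-mod : ∀ t → Next (t mod n) (suc t mod n)
  next-mod t with suc-% {n} t
  ... | inj₁ eq       = step (trans (cong suc (toℕ-mod t)) (trans (sym eq) (sym (toℕ-mod (suc t)))))
  ... | inj₂ (e , e₀) = wrap (trans (cong suc (toℕ-mod t)) e) (trans (toℕ-mod (suc t)) e₀)

  -- Adding `pred n` goes back one place without a truncated subtraction at vertex 0.
  previous : Fin n → Fin n
  previous i = (pred n + toℕ i) mod n

  suc-previous : (i : Fin n) → suc (pred n + toℕ i) ≡ n + toℕ i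
  suc-previous i = cong (_+ toℕ i) (suc-pred n)

  next-previous : ∀ i → Next (previous i) i
  next-previous i = subst (Next (previous i)) (trans (cong (_mod n) (suc-previous i)) (n+toℕ-mod-id i))
                          (next-mod (pred n + toℕ i))

-- Induced subgraphs of the cycle.

module InducedCycle {n : ℕ} .{{_ : NonZero n}} (3≤n : 3 ≤ n)
                    (U : Fin n → Bool) (u₀ : ∃ (T ∘ U)) where

  H = induced (Cycle n 3≤n) U u₀
  open Graph H

  position : V → ℕ
  position = toℕ ∘ proj₁

  vertex-≡ : {x y : V} → proj₁ x ≡ proj₁ y → x ≡ y
  vertex-≡ {_ , t} {_ , t′} refl = cong (_ ,_) (T-irrelevant t t′)

  position-injective : {x y : V} → position x ≈ position y [mod n ] → x ≡ y
  position-injective {x} {y} e =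
    vertex-≡ (toℕ-injective (≈-small (toℕ<n (proj₁ x)) (toℕ<n (proj₁ y)) e))

  finite : Finite H
  finite = record
    { _≟ᵛ_     = λ x y → map′ vertex-≡ (cong proj₁) (proj₁ x Fin.≟ proj₁ y)
    ; _~?_     = λ x y → map′ (to {x} {y}) (from {x} {y}) (next? (proj₁ x) (proj₁ y) ⊎-dec next? (proj₁ y) (proj₁ x))
    ; elements = concatMap fibre (allFin n)
    ; complete = λ { (i , t) → ∈-concatMap⁺ fibre (lose (∈-allFin i) (∈-fibre i t)) }
    }
    where
    next? : (i j : Fin n) → Dec (Next i j)
    next? i j = map′ [ step , (λ (e , z) → wrap e z) ] (λ { (step e) → inj₁ e ; (wrap e z) → inj₂ (e , z) })
                     ((suc (toℕ i) ≟ toℕ j) ⊎-dec ((suc (toℕ i) ≟ n) ×-dec (toℕ j ≟ 0)))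
    to : ∀ {x y} → Next (proj₁ x) (proj₁ y) ⊎ Next (proj₁ y) (proj₁ x) → x ~ y
    to (inj₁ r) = fwd r
    to (inj₂ r) = bwd r
    from : ∀ {x y} → x ~ y → Next (proj₁ x) (proj₁ y) ⊎ Next (proj₁ y) (proj₁ x)
    from (fwd r) = inj₁ r
    from (bwd r) = inj₂ r
    fibre : Fin n → List V
    fibre i with T? (U i)
    ... | yes t = (i , t) ∷ []
    ... | no  _ = []
    ∈-fibre : ∀ i (t : T (U i)) → (i , t) ∈ fibre i
    ∈-fibre i t with T? (U i)
    ... | yes t′ = here (vertex-≡ refl)
    ... | no ¬t  = contradiction t ¬t

  -- The common abstraction of `position` and `label`. Only pairs of vertices of `H` are
  -- constrained, so the value may reset across an omitted vertex.
  Rising : (m : ℕ) .{{_ : NonZero m}} → (V → ℕ) → Set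
  Rising m r = ∀ x y → Next (proj₁ x) (proj₁ y) → r y ≈ suc (r x) [mod m ]

  position-rising : Rising n position
  position-rising _ _ (step e)   = ≈-reflexive (sym e)
  position-rising _ _ (wrap e z) = ≈-trans (≈-reflexive z) (≈-sym (≈-trans (≈-reflexive e) m≈0))

  -- A short walk has a signed displacement, recorded with an offset of D to
  -- stay in ℕ.
  shift : ∀ {D x y} (p : Walk H x y) → walkLength H p < D →
          ∃ λ k → k ≤ D + walkLength H p × D ≤ k + walkLength H p ×
            (∀ {m} .{{_ : NonZero m}} r → Rising m r → r y + D ≈ r x + k [mod m ])
  shift {D} ε _ = D , m≤m+n D 0 , m≤m+n D 0 , λ _ _ → ≈-reflexive refl
  shift {D} {x} (_◅_ {j = z} (fwd e) p) ℓ<D with k , k≤ , D≤ , h ← shift p (<-trans (n<1+n _) ℓ<D)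
    = suc k
    , ≤-trans (s≤s k≤) (≤-reflexive (sym (+-suc D _)))
    , ≤-trans D≤ (≤-trans (n≤1+n _) (s≤s (+-monoʳ-≤ k (n≤1+n _))))
    , λ r rising → ≈-trans (h r rising) (≈-trans (≈-+ʳ k (rising x z e)) (≈-reflexive (sym (+-suc (r x) k))))
  shift {D} {x} (_◅_ {j = z} (bwd e) p) ℓ<D with shift p (<-trans (n<1+n _) ℓ<D)
  -- An offset of 0 would require at least `D` edges, so the offset can always be lowered by one.
  ... | zero  , _  , D≤ , _ = contradiction (≤-trans ℓ<D (≤-trans D≤ (n≤1+n _))) 1+n≰n
  ... | suc k , k≤ , D≤ , h
    = k
    , ≤-trans (n≤1+n k) (≤-trans k≤ (+-monoʳ-≤ D (n≤1+n _)))
    , ≤-trans D≤ (≤-reflexive (sym (+-suc k _)))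
    , λ r rising → ≈-trans (h r rising) (≈-trans (≈-reflexive (+-suc (r z) k)) (≈-+ʳ k (≈-sym (rising z x e))))

  module _ {d : ℕ} where

    private D = suc d

    -- One offset serves all rising functions and all moduli at once. This lets information modulo
    -- `D` be carried over to `position` modulo `n`.
    near-shift : ∀ {x y} → Near H d x y →
                 ∃ λ k → 0 < k × k < D + D ×
                   (∀ {m} .{{_ : NonZero m}} r → Rising m r → r y + D ≈ r x + k [mod m ])
    near-shift (p , p≤d) with k , k≤ , D≤ , h ← shift {D} p (s≤s p≤d)
      = k , +-cancelʳ-< _ 0 k (≤-trans (s≤s p≤d) D≤) , ≤-<-trans k≤ (+-monoʳ-< D (s≤s p≤d)) , h

    -- Equal colours make the offset a multiple of `D`, hence `D` itself. The displacement is then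
    -- zero, and reading it through `position` identifies the vertices.
    rising-proper : ∀ r → Rising D r → ∀ {x y} → r x ≈ r y [mod D ] → Near H d x y → x ≡ y
    rising-proper r rising {x} {y} rx≈ry near with k , 0<k , k<2D , h ← near-shift near
      with refl ← ≈0⇒≡m 0<k k<2D (≈-trans (≈-cancelˡ (r x) (≈-trans (≈-sym (h r rising)) (≈-+ʳ D (≈-sym rx≈ry)))) m≈0)
      = sym (position-injective (≈-cancelʳ D (h position position-rising)))

    -- The offset displacement from a fixed member of the clique, modulo D, is
    -- a colouring of the clique: two members with the same colour are equal
    -- or D apart.
    clique-length≤ : D + D ≤ n → ∀ {S} → Unique S → Clique H 2 d S → length S ≤ D
    clique-length≤ 2D≤n {[]} _ _ = z≤n
    clique-length≤ 2D≤n {S@(x ∷ _)} uniq clique = length≤ uniq key key-injective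
      where
      offset : ∀ {y} → y ∈ S → ∃ λ k → 0 < k × k < D + D × position y + D ≈ position x + k [mod n ]
      offset y∈ with k , 0<k , k<2D , h ← near-shift (clique⇒near finite clique (here refl) y∈)
        = k , 0<k , k<2D , h position position-rising
      key : ∀ {y} → y ∈ S → Fin D
      key y∈ = proj₁ (offset y∈) mod D
      -- Otherwise `l` = `k + D`, so `z` lies `D` places after `y`. Nearness gives an offset `j`
      -- with `2D ≈ j` modulo `n`; as 0 < `j` < 2D ≤ `n`, the difference `2D - j` is positive and
      -- less than `n`, which is impossible.
      ¬ahead : ∀ {y z k l} → y ∈ S → z ∈ S → position y + D ≈ position x + k [mod n ] →
               position z + D ≈ position x + l [mod n ] → l < D + D → k ≈ l [mod D ] → ¬ k < l
      ¬ahead {y} {z} {k} {l} y∈ z∈ hy hz l<2D k≈l k<l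
        with j , 0<j , j<2D , h ← near-shift (clique⇒near finite clique y∈ z∈)
        = ≤⇒≯ (m∸n≡0⇒m≤n (≈-gap (position y + j) (<-≤-trans (∸-monoʳ-< 0<j (<⇒≤ j<2D)) 2D≤n)
            (≈-trans (≈-sym (h position position-rising)) (≈-trans (≈-+ʳ D z≈y+D) (≈-reflexive
              (trans (+-assoc (position y) D D) (trans (cong (position y +_) (sym (m+[n∸m]≡n (<⇒≤ j<2D))))
                (sym (+-assoc (position y) j _))))))))) j<2D
        where
        l∸k≡D : l ∸ k ≡ D
        l∸k≡D = ≈0⇒≡m (m<n⇒0<n∸m k<l) (≤-<-trans (m∸n≤m l k) l<2D) (≈-cancelˡ k (≈-trans
          (≈-reflexive (m+[n∸m]≡n (<⇒≤ k<l))) (≈-trans (≈-sym k≈l) (≈-reflexive (sym (+-identityʳ k))))))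
        z≈y+D : position z ≈ position y + D [mod n ]
        z≈y+D = ≈-cancelʳ D (≈-trans hz (≈-trans (≈-reflexive (begin
          position x + l             ≡⟨ cong (position x +_) (m+[n∸m]≡n (<⇒≤ k<l)) ⟨
          position x + (k + (l ∸ k)) ≡⟨ cong (λ e → position x + (k + e)) l∸k≡D ⟩
          position x + (k + D)       ≡⟨ +-assoc (position x) k D ⟨
          position x + k + D         ∎)) (≈-+ʳ D (≈-sym hy))))
          where open ≡-Reasoning
      key-injective : ∀ {y z} (y∈ : y ∈ S) (z∈ : z ∈ S) → key y∈ ≡ key z∈ → y ≡ z
      key-injective y∈ z∈ e =
        let k , _ , k<2D , hy = offset y∈
            l , _ , l<2D , hz = offset z∈
            k≈l = mod-eq (fromℕ<-injective _ _ _ _ e)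
            l≡k = ≤-antisym (≮⇒≥ (¬ahead y∈ z∈ hy hz l<2D k≈l)) (≮⇒≥ (¬ahead z∈ y∈ hz hy k<2D (≈-sym k≈l)))
        in position-injective (≈-cancelʳ D (≈-trans hy (≈-trans (≈-reflexive (cong (_ +_) (sym l≡k))) (≈-sym hz))))

    -- The palette stops at the largest colour that occurs, so that the clique found by `descend`
    -- has exactly as many vertices as there are colours.
    χ≡ω-rising : ∀ r → Rising D r → (∀ y → r y % D ≢ 0 → ∃ λ x → Next (proj₁ x) (proj₁ y)) →
                 Chromatic≡Clique H d
    χ≡ω-rising r rising previous =
      let S , len , _ , pairs , uniq = descend (colour top) top refl
      in χ≡ω finite (λ x → fromℕ< (s≤s (colour≤ x)))
           (λ e → rising-proper r rising (mod-eq (fromℕ<-injective _ _ _ _ e)))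
           S uniq (allPairs⇒clique finite pairs) len
      where
      open Finite finite
      colour : V → ℕ
      colour x = r x % D
      top : V
      top = argmax colour nonempty elements
      colour≤ : ∀ x → colour x ≤ colour top
      colour≤ x = All.lookup (f[xs]≤f[argmax] {f = colour} nonempty elements) (complete x)
      colour-previous : ∀ {x z j} → Next (proj₁ z) (proj₁ x) → colour x ≡ suc j → colour z ≡ j
      colour-previous {x} {z} next e with suc-% {D} (r z) | trans (sym (%-≡ (rising z x next))) e
      ... | inj₁ eq       | e′ = suc-injective (trans (sym eq) e′)
      -- A wrap modulo `D` would give `x` colour 0.
      ... | inj₂ (_ , eq) | e′ = contradiction (trans (sym eq) e′) 0≢1+n
      -- The invariant on distances makes the new vertex near all earlier ones, since colours never
      -- exceed `d`; the invariant on colours makes it different from them.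
      descend : ∀ j x → colour x ≡ j →
                Σ[ S ∈ List V ] length S ≡ suc j × All (λ y → Near H j x y × colour y ≤ j) S ×
                                AllPairs (Near H d) S × Unique S
      descend zero    x e = x ∷ [] , refl , (near-refl , ≤-reflexive e) ∷ [] , [] ∷ [] , [] ∷ []
      descend (suc j) x e with z , next ← previous x (λ e₀ → 0≢1+n (trans (sym e₀) e))
        with S , len , all , pairs , uniq ← descend j z (colour-previous next e)
        = x ∷ S , cong suc len
        , (near-refl , ≤-reflexive e) ∷ All.map (λ (near , c≤) → near-step (bwd next) near , m≤n⇒m≤1+n c≤) all
        , All.map (λ (near , _) → near-mono j<d (near-step (bwd next) near)) all ∷ pairs
        , All.map (λ (_ , c≤) → λ { refl → 1+n≰n (≤-trans (≤-reflexive (sym e)) c≤) }) all ∷ uniq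
        where
        j<d : j < d
        j<d = s≤s⁻¹ (subst (_< D) e (m%n<n (r x) D))

  -- The whole cycle.

  module Full (full : ∀ i → T (U i)) where

    at : ℕ → V
    at t = t mod n , full (t mod n)

    at-≈ : ∀ {s t} → at s ≡ at t → s ≈ t [mod n ]
    at-≈ {s} {t} e = mod-eq (trans (sym (toℕ-mod s)) (trans (cong position e) (toℕ-mod t)))

    at-position : ∀ x → at (position x) ≡ x
    at-position x = vertex-≡ (toℕ-mod-id (proj₁ x))

    climb : ∀ k t → Near H k (at t) (at (k + t))
    climb zero    t = near-refl
    climb (suc k) t = near-step (fwd (next-mod t))
                        (subst (λ s → Near H k (at (suc t)) (at s)) (+-suc k t) (climb k (suc t)))

    position-rising-divisor : ∀ {m} .{{_ : NonZero m}} → m ∣ n → Rising m position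
    position-rising-divisor m∣n _ _ (step e) = ≈-reflexive (sym e)
    position-rising-divisor {m} m∣n _ _ (wrap e z) =
      mod-eq (trans (cong (_% m) z) (trans (m*n%n≡0 0 m) (sym (trans (cong (_% m) e) (n∣m⇒m%n≡0 n m m∣n)))))

    module _ {d : ℕ} where

      -- The two arcs between `x` and `y` have `n` ≤ 2d + 1 edges together, so one of them has at
      -- most `d`. The second arc runs forward from `y` past vertex 0.
      near-position≤ : n ≤ suc (d + d) → ∀ {x y} → position x ≤ position y → Near H d x y
      near-position≤ n≤ {x} {y} x≤y with position y ∸ position x ≤? d
      ... | yes le = subst₂ (Near H d) (at-position x) (trans (cong at (m∸n+n≡m x≤y)) (at-position y))
                            (near-mono le (climb (position y ∸ position x) (position x)))
      ... | no  gt = near-sym (subst₂ (Near H d) (at-position y) around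
                                 (near-mono n∸gap≤d (climb (n ∸ gap) (position y))))
        where
        gap = position y ∸ position x
        gap≤n : gap ≤ n
        gap≤n = ≤-trans (m∸n≤m _ (position x)) (<⇒≤ (toℕ<n (proj₁ y)))
        n∸gap≤d : n ∸ gap ≤ d
        n∸gap≤d = m≤n+o⇒m∸n≤o n gap (≤-trans n≤ (+-monoˡ-≤ d (≰⇒> gt)))
        around : at (n ∸ gap + position y) ≡ x
        around = vertex-≡ (trans (cong (_mod n) (begin
          n ∸ gap + position y         ≡⟨ cong (n ∸ gap +_) (m∸n+n≡m x≤y) ⟨
          n ∸ gap + (gap + position x) ≡⟨ +-assoc (n ∸ gap) gap _ ⟨
          n ∸ gap + gap + position x   ≡⟨ cong (_+ position x) (m∸n+n≡m gap≤n) ⟩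
          n + position x               ∎)) (n+toℕ-mod-id (proj₁ x)))
          where open ≡-Reasoning

      near-any : n ≤ suc (d + d) → ∀ x y → Near H d x y
      near-any n≤ x y with ≤-total (position x) (position y)
      ... | inj₁ x≤y = near-position≤ n≤ x≤y
      ... | inj₂ y≤x = near-sym (near-position≤ n≤ y≤x)

      χ≡ω-small : n ≤ suc (d + d) →
                  Chromatic≡Clique H d
      χ≡ω-small n≤ = χ≡ω finite proj₁ (λ e _ → vertex-≡ e) (map (λ i → i , full i) (allFin n))
        (Unique.map⁺ (cong proj₁) (allFin⁺ n)) (near⇒clique finite λ _ _ → near-any n≤ _ _)
        (trans (length-map _ (allFin n)) (length-tabulate id))

      χ≡ω-divisible : suc d ∣ n →
                      Chromatic≡Clique H d
      χ≡ω-divisible D∣n = χ≡ω-rising position (position-rising-divisor D∣n)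
        λ (i , _) _ → (previous i , full (previous i)) , next-previous i

      -- Among d + 2 consecutive vertices two share a colour, and these can
      -- only be the first and the last; so the colouring has period d + 1.
      colourable⇒divisible : suc d < n → ∀ {c} → c ≤ suc d → Colorable H 2 d c → suc d ∣ n
      -- Vertices 0 and `n % D` share a colour at distance at most `d`, so they coincide; as `n % D`
      -- < `n`, the remainder is 0.
      colourable⇒divisible D<n {c} c≤D (f , ind) = m%n≡0⇒n∣m n D
        (≈-gap 0 (<-trans (m%n<n n D) D<n) (≈-trans (at-≈ (proper (<⇒≤pred (m%n<n n D)) F[n%D]))
            (≈-reflexive (+-identityʳ (n % D)))))
        where
        D = suc d
        F : ℕ → Fin c
        F = f ∘ at
        proper : ∀ {k t} → k ≤ d → F t ≡ F (k + t) → at t ≡ at (k + t)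
        proper {k} {t} k≤d e = independent⇒near-≡ finite (ind _) refl (sym e) (near-mono k≤d (climb k t))
        period : ∀ t → F (D + t) ≡ F t
        period t with i , j , i<j , e ← Fin.pigeonhole (s≤s c≤D) (λ (i : Fin (suc D)) → F (toℕ i + t))
          with toℕ j ∸ toℕ i ≤? d
        -- Equally coloured vertices this close coincide, but the gap is positive and less than `n`.
        ... | yes gap≤d = contradiction gap≡0 (m>n⇒m∸n≢0 i<j)
          where
          j+t≡ : toℕ j ∸ toℕ i + (toℕ i + t) ≡ toℕ j + t
          j+t≡ = trans (sym (+-assoc (toℕ j ∸ toℕ i) (toℕ i) t)) (cong (_+ t) (m∸n+n≡m (<⇒≤ i<j)))
          gap≡0 : toℕ j ∸ toℕ i ≡ 0
          gap≡0 = ≈-gap (toℕ i + t) (≤-<-trans gap≤d (<-trans (n<1+n d) D<n))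
            (≈-trans (at-≈ (proper gap≤d (trans e (cong F (sym j+t≡))))) (≈-reflexive (+-comm _ (toℕ i + t))))
        ... | no gap≰d = trans (cong (λ l → F (l + t)) (sym j≡D)) (trans (sym e) (cong (λ l → F (l + t)) i≡0))
          where
          j≤D : toℕ j ≤ D
          j≤D = <⇒≤pred (toℕ<n j)
          j≡D : toℕ j ≡ D
          j≡D = ≤-antisym j≤D (≤-trans (≰⇒> gap≰d) (m∸n≤m (toℕ j) (toℕ i)))
          i≡0 : toℕ i ≡ 0
          i≡0 = n≤0⇒n≡0 (+-cancelʳ-≤ D (toℕ i) 0 (≤-trans (+-monoʳ-≤ (toℕ i) (≰⇒> gap≰d))
                  (≤-trans (≤-reflexive (m+[n∸m]≡n (<⇒≤ i<j))) j≤D)))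
        periods : ∀ q t → F (q * D + t) ≡ F t
        periods zero    t = refl
        periods (suc q) t = trans (cong F (+-assoc D (q * D) t)) (trans (period (q * D + t)) (periods q t))
        -- The trailing `+ 0` fits the form `k + t` in `proper`, with `t` = 0.
        F[n%D] : F 0 ≡ F (n % D + 0)
        F[n%D] = begin
          F 0                     ≡⟨ cong f (vertex-≡ (mod-cong m≈0)) ⟨
          F n                     ≡⟨ cong F (trans (m≡m%n+[m/n]*n n D) (+-comm (n % D) _)) ⟩
          F (n / D * D + n % D)   ≡⟨ periods (n / D) (n % D) ⟩
          F (n % D)               ≡⟨ cong F (+-identityʳ (n % D)) ⟨
          F (n % D + 0)           ∎
          where open ≡-Reasoning

  -- The cycle with a vertex omitted.

  module Missing (w : Fin n) (w∉U : ¬ T (U w)) where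

    -- The number of consecutive indices just below the argument whose residues lie in `U`, counting
    -- no further down than index 0.
    run : ℕ → ℕ
    run zero    = 0
    run (suc t) = if U (t mod n) then suc (run t) else 0

    run-in : ∀ {t} → T (U (t mod n)) → run (suc t) ≡ suc (run t)
    run-in {t} h with U (t mod n)
    ... | true = refl

    run-out : ∀ {t} → ¬ T (U (t mod n)) → run (suc t) ≡ 0
    run-out {t} h with U (t mod n)
    ... | true  = contradiction _ h
    ... | false = refl

    run-nonzero : ∀ {t} → run (suc t) ≢ 0 → T (U (t mod n))
    run-nonzero {t} h = decidable-stable (T? _) (h ∘ run-out)

    -- Just after `w` the run is 0 on either lap, whatever came before; from there both laps follow
    -- the same recursion.
    run-periodic : ∀ k → run (n + (k + suc (toℕ w))) ≡ run (k + suc (toℕ w))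
    run-periodic zero = trans (cong run (+-suc n (toℕ w))) (trans
      (run-out (w∉U ∘ subst (T ∘ U) (n+toℕ-mod-id w))) (sym (run-out (w∉U ∘ subst (T ∘ U) (toℕ-mod-id w)))))
    run-periodic (suc k) = trans (cong run (+-suc n t)) (cong₂ (λ b l → if b then suc l else 0)
      (cong U (mod-cong {n} (≈-+ʳ t m≈0))) (run-periodic k))
      where t = k + suc (toℕ w)

    -- Read off on the second lap: on the first, the run through vertex 0 is
    -- truncated.
    label : V → ℕ
    label x = run (n + position x)

    -- Index `n` is at or beyond `suc (toℕ w)`, hence in the periodic range. This closes the wrap
    -- edge in `label-rising`.
    run[n] : run (n + n) ≡ run n
    run[n] = subst (λ t → run (n + t) ≡ run t) (m∸n+n≡m (toℕ<n w)) (run-periodic (n ∸ suc (toℕ w)))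

    label-suc : ∀ x → run (n + suc (position x)) ≡ suc (label x)
    label-suc (i , t) = trans (cong run (+-suc n (toℕ i))) (run-in (subst (T ∘ U) (sym (n+toℕ-mod-id i)) t))

    label-rising : ∀ {m} .{{_ : NonZero m}} → Rising m label
    label-rising x y (step e)   = ≈-reflexive (trans (cong (λ l → run (n + l)) (sym e)) (label-suc x))
    label-rising x y (wrap e z) = ≈-reflexive (begin
      run (n + position y)       ≡⟨ cong (λ l → run (n + l)) z ⟩
      run (n + 0)                ≡⟨ cong run (+-identityʳ n) ⟩
      run n                      ≡⟨ run[n] ⟨
      run (n + n)                ≡⟨ cong (λ l → run (n + l)) e ⟨
      run (n + suc (position x)) ≡⟨ label-suc x ⟩
      suc (label x)              ∎)
      where open ≡-Reasoning

    χ≡ω-missing : ∀ {d} → Chromatic≡Clique H d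
    χ≡ω-missing {d} = χ≡ω-rising label label-rising λ (i , _) ≢0 →
      -- A nonzero colour comes from a nonzero run, and then the preceding vertex lies in `U`.
      (previous i , run-nonzero (λ run≡0 → ≢0 (cong (_% suc d)
        (trans (cong run (sym (suc-previous i))) run≡0)))) , next-previous i

theorem5p9 : (d n : ℕ) → 1 ≤ d → (4≤n : 4 ≤ n) →
    Perfect 2 d (Cycle n (<⇒≤ 4≤n)) ⇔
    (n ≤ 2 * d + 1 ⊎ (2 * d + 2 ≤ n × (d + 1) ∣ n))
theorem5p9 d n@(suc _) 1≤d 4≤n = mk⇔ to from
  where
  2d+1≡ : 2 * d + 1 ≡ suc (d + d)
  2d+1≡ = trans (+-comm (2 * d) 1) (cong (λ l → suc (d + l)) (+-identityʳ d))
  2d+2≡ : 2 * d + 2 ≡ suc d + suc d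
  2d+2≡ = trans (+-suc (2 * d) 1) (cong suc (trans 2d+1≡ (sym (+-suc d d))))
  to : Perfect 2 d (Cycle n (<⇒≤ 4≤n)) → n ≤ 2 * d + 1 ⊎ (2 * d + 2 ≤ n × (d + 1) ∣ n)
  to perfect with n ≤? 2 * d + 1 | perfect (λ _ → true) (Fin.zero , _)
  ... | yes n≤ | _ = inj₁ n≤
  ... | no  n≰ | χ , ω , ((_ , colourable) , _) , (_ , ω-least) , χ≡ =
    -- The clique bound makes `D` an upper bound and `ω` is the least one, so `χ` = `ω` ≤ `D`.
    inj₂ (2d+2≤n , subst (_∣ n) (+-comm 1 d) (Full.colourable⇒divisible _
      (<-≤-trans (m<m+n (suc d) z<s) 2D≤n) (≤-trans (≤-reflexive (trans χ≡ (trans (n/1≡n _) (+-identityʳ ω))))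
        (ω-least (suc d) λ { _ (S , uniq , clique , refl) → clique-length≤ 2D≤n uniq clique })) colourable))
    where
    open InducedCycle (<⇒≤ 4≤n) (λ _ → true) (Fin.zero , _)
    2d+2≤n : 2 * d + 2 ≤ n
    2d+2≤n = subst (_≤ n) (sym (+-suc (2 * d) 1)) (≰⇒> n≰)
    2D≤n : suc d + suc d ≤ n
    2D≤n = subst (_≤ n) 2d+2≡ 2d+2≤n
  from : n ≤ 2 * d + 1 ⊎ (2 * d + 2 ≤ n × (d + 1) ∣ n) → Perfect 2 d (Cycle n (<⇒≤ 4≤n))
  from cases U u with Fin.any? (λ i → ¬? (T? (U i)))
  ... | yes (w , w∉U) = InducedCycle.Missing.χ≡ω-missing (<⇒≤ 4≤n) U u w w∉U
  ... | no  none = [ (λ n≤ → χ≡ω-small (subst (n ≤_) 2d+1≡ n≤))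
                   , (λ (_ , D∣n) → χ≡ω-divisible (subst (_∣ n) (+-comm d 1) D∣n)) ] cases
    where
    open InducedCycle (<⇒≤ 4≤n) U u
    open Full (λ i → decidable-stable (T? (U i)) (λ i∉U → none (i , i∉U)))
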